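{- The transience class of the Abelian sandpile model on the $n \times n$ grid $\square_n$ satisfies $\mathrm{tcl}(\square_n) = \Omega(n^{4})$ as $n\to\infty$.
   Context: The graph $\square_n$ has vertex set $\{1,\dots,n\}^2 \cup \{s\}$, where $s$ is a sink vertex. Two non-sink vertices are joined by an edge if they differ by exactly $1$ in exactly one coordinate. Each boundary vertex is joined to $s$ by additional (possibly parallel) edges so that every non-sink vertex has degree exactly $4$. Abelian sandpile model on a finite multigraph $G$ with sink $s$: a configuration assigns a nonnegative integer number of grains $\sigma(v)$ to each non-sink vertex $v$. A non-sink vertex $v$ with $\sigma(v)\ge \deg(v)$ may topple, sending one grain along each incident edge; grains sent to $s$ disappear. A configuration in which no vertex can topple is stable. Repeated toppling always terminates, and the resulting stable configuration does not depend on the order of topplings. One step of the process adds one grain at a chosen non-sink vertex and then stabilizes. A stable configuration is recurrent if it can be revisited by this process; otherwise it is transient. The transience class $\mathrm{tcl}(G)$ is the maximum number of grains that can be added, one at a time at adversarially chosen non-sink vertices and stabilizing after each addition, starting from the empty (all-zero) configuration, before the configuration necessarily becomes recurrent. -}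

module Defs where

open import Data.Nat using (ℕ; zero; suc; _+_; _∸_; _<_; _≤_; _≡ᵇ_)
open import Data.Fin using (Fin; toℕ)
open import Data.Product using (_×_; _,_; Σ; ∃)
open import Data.Bool using (Bool; true; false; if_then_else_; _∧_; _∨_)
open import Data.List using (List; []; _∷_; length)
open import Relation.Binary.PropositionalEquality using (_≡_)
open import Relation.Binary.Construct.Closure.ReflexiveTransitive using (Star)

-- Non-sink vertices of the grid graph □_n : pairs of coordinates (0-based).
Vertex : ℕ → Set
Vertex n = Fin n × Fin n

Config : ℕ → Set
Config n = Vertex n → ℕ

empty : ∀ {n} → Config n
empty _ = 0

eqV : ∀ {n} → Vertex n → Vertex n → Bool
eqV (i , j) (k , l) = (toℕ i ≡ᵇ toℕ k) ∧ (toℕ j ≡ᵇ toℕ l)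

diff1 : ℕ → ℕ → Bool
diff1 a b = (suc a ≡ᵇ b) ∨ (suc b ≡ᵇ a)

adj : ∀ {n} → Vertex n → Vertex n → Bool
adj (i , j) (k , l) =
  ((toℕ i ≡ᵇ toℕ k) ∧ diff1 (toℕ j) (toℕ l)) ∨
  ((toℕ j ≡ᵇ toℕ l) ∧ diff1 (toℕ i) (toℕ k))

-- Every non-sink vertex has degree 4 (the missing grid edges go to the sink).
deg : ℕ
deg = 4

-- Result of toppling vertex v: v loses 4 grains, each grid neighbour gains
-- one; grains sent to the sink disappear.
topple : ∀ {n} → Vertex n → Config n → Config n
topple v σ x =
  if eqV v x then σ x ∸ deg
  else (if adj v x then suc (σ x) else σ x)

data Topple {n : ℕ} : Config n → Config n → Set where
  topple-at : ∀ (σ : Config n) (v : Vertex n) → deg ≤ σ v → Topple σ (topple v σ)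

Stable : ∀ {n} → Config n → Set
Stable σ = ∀ x → σ x < deg

addGrain : ∀ {n} → Vertex n → Config n → Config n
addGrain v σ x = if eqV v x then suc (σ x) else σ x

Stabilizes : ∀ {n} → Config n → Config n → Set
Stabilizes σ τ = Star Topple σ τ × Stable τ

data Process {n : ℕ} : Config n → List (Vertex n) → Config n → Set where
  done : ∀ σ → Process σ [] σ
  step : ∀ {σ τ ρ} v vs → Stabilizes (addGrain v σ) τ → Process τ vs ρ →
         Process σ (v ∷ vs) ρ

Recurrent : ∀ {n} → Config n → Set
Recurrent {n} σ =
  Σ (Vertex n) λ v → Σ (List (Vertex n)) λ vs → Σ (Config n) λ τ →
    Process σ (v ∷ vs) τ × (∀ x → τ x ≡ σ x)

NecessarilyRecurrentAfter : ℕ → ℕ → Set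
NecessarilyRecurrentAfter n t =
  ∀ (vs : List (Vertex n)) (σ : Config n) →
    length vs ≡ t → Process empty vs σ → Recurrent σ

{-# OPTIONS --safe #-}
module Submission where

-- Let every grain fall on one corner of the grid, and let h ≥ 0 be a superharmonic function
-- on the grid and its boundary.  Toppling does not increase the energy Σ σ(x) h(x), so after t additions
-- the energy is at most t h(corner), and no vertex x with h(x) > t h(corner) can carry a grain.
-- If the opposite corner p and a neighbour q of p are both empty, the configuration is not recurrent:
-- a run returning to it would have to topple both, and the last of the two topplings
-- leaves a grain on the other vertex.  So it suffices that h(p) and h(q) exceed
-- h(corner) by a factor of order n⁴.
--
-- With (a , b) the coordinates counted from p and (x , y) those counted from the corner, h is made of
-- the harmonic function κ x y, and of n⁴ a b / (a² + b² + 3)², a perturbation of the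
-- harmonic function a b / (a² + b²)² ~ Im z⁻² which absorbs the discretisation error.
-- On the antidiagonal a b = x y, and the second function is below the first once κ is a constant.
-- Hence their minimum beyond the antidiagonal continues the second function on the side of p
-- to a superharmonic function on the grid.

open import Defs
open import Data.Bool using (Bool; true; false; if_then_else_; _∧_; _∨_)
open import Data.Bool.Properties using (∧-distribˡ-∨; ∧-comm; ∧-zeroʳ; ∨-zeroʳ; T-≡; T-∧)
open import Data.Fin using (Fin; zero; suc; toℕ; inject₁; fromℕ)
open import Data.Fin.Induction using (<-weakInduction)
open import Data.Fin.Properties using (toℕ-injective; toℕ<n; toℕ-inject₁; toℕ-fromℕ; any?)
open import Data.List using ([]; _∷_; replicate)
open import Data.List.Properties using (length-replicate)
open import Data.Nat
open import Data.Nat.DivMod using (m/n*n≡m)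
open import Data.Nat.Divisibility using (_∣_; ∣-trans; m≤n⇒m!∣n!; m∣m*n)
open import Data.Nat.Properties
open import Data.Nat.Solver using (module +-*-Solver)
open import Data.Nat.Tactic.RingSolver using (solve-∀)
open import Data.Product
open import Data.Sum
open import Function using (_∘_; Equivalence)
open import Relation.Binary.Construct.Closure.ReflexiveTransitive using (Star; ε; _◅_)
open import Relation.Binary.PropositionalEquality
open import Relation.Nullary using (yes; no; contradiction)
open import Algebra.Properties.CommutativeMonoid.Sum +-0-commutativeMonoid
  using (sum; sum-cong-≗; ∑-distrib-+)

-- The superharmonic function

sq : ℕ → ℕ
sq m = m * m

-- With `x` = a², `y` = b² and d± = 3 + (a ± 1)² + b², the sum (a + 1) / d₊² + (a - 1) / d₋² equals
-- 2 a `weight x y` / `sq (pairProd x y)`.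
weight : ℕ → ℕ → ℕ
weight x y = (x + y + 4) * (x + y) + 4 * x

-- For x = a² and y = b² this is the product of the numbers 3 + (a ± 1)² + b².
pairProd : ℕ → ℕ → ℕ
pairProd x y = sq (x + y) + 4 * (x + y) + 16 + 4 * y

-- The difference of the two sides of radial-≤.  The 3 in the denominators a² + b² + 3 is the least integer
-- for which its coefficients are all nonnegative.
slack : ℕ → ℕ → ℕ
slack r m = 6 * r ^ 6 + 348 * r ^ 5 + 4560 * r ^ 4 + 27840 * r ^ 3 + 93184 * r ^ 2 + 168960 * r + 131072
        + m * (10 * r ^ 4 + 120 * r ^ 3 + 590 * r ^ 2 + 1476 * r + 1600) + 2 * m ^ 2

radial-ident : ∀ x y →
  sq (3 + (x + y)) * (weight x y * sq (pairProd y x) + weight y x * sq (pairProd x y))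
    + slack (x + y) (16 * (x * y))
  ≡ 2 * (sq (pairProd x y) * sq (pairProd y x))
radial-ident = solve 2 (λ x y → 
  sq' (con 3 :+ (x :+ y)) :* (weight' x y :* sq' (pairProd' y x) :+ weight' y x :* sq' (pairProd' x y))
    :+ slack' (x :+ y) (con 16 :* (x :* y))
  := con 2 :* (sq' (pairProd' x y) :* sq' (pairProd' y x))) refl
  where
  open +-*-Solver
  P = Polynomial 2
  sq' : P → P
  sq' m = m :* m
  weight' pairProd' slack' : P → P → P
  weight' x y = (x :+ y :+ con 4) :* (x :+ y) :+ con 4 :* x
  pairProd' x y = sq' (x :+ y) :+ con 4 :* (x :+ y) :+ con 16 :+ con 4 :* y
  slack' r m = con 6 :* r :^ 6 :+ con 348 :* r :^ 5 :+ con 4560 :* r :^ 4 :+ con 27840 :* r :^ 3 :+ con 93184 :* r :^ 2 :+ con 168960 :* r :+ con 131072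
        :+ m :* (con 10 :* r :^ 4 :+ con 120 :* r :^ 3 :+ con 590 :* r :^ 2 :+ con 1476 :* r :+ con 1600) :+ con 2 :* m :^ 2

-- This is superharmonicity of a b / (a² + b² + 3)² with the common factor 2 a b cancelled and the
-- denominators cleared. The two summands on the left come from the two pairs of opposite
-- neighbours.
radial-≤ : ∀ x y →
  sq (3 + (x + y)) * (weight x y * sq (pairProd y x) + weight y x * sq (pairProd x y))
  ≤ 2 * (sq (pairProd x y) * sq (pairProd y x))
radial-≤ x y = ≤-trans (m≤m+n _ (slack (x + y) (16 * (x * y)))) (≤-reflexive (radial-ident x y))

opposite-pair : ∀ k y q₁ q₂ {V} →
  q₁ * (3 + (sq (2 + k) + y)) ≡ V →
  q₂ * (3 + (sq k + y)) ≡ V →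
  ((2 + k) * sq q₁ + k * sq q₂) * sq (pairProd (sq (suc k)) y)
    ≡ 2 * suc k * weight (sq (suc k)) y * sq V
opposite-pair k y q₁ q₂ {V} e₁ e₂ = begin
  ((2 + k) * sq q₁ + k * sq q₂) * sq (pairProd (sq (suc k)) y)
    ≡⟨ cong (λ p → ((2 + k) * sq q₁ + k * sq q₂) * sq p) (prod-ident k y) ⟩
  ((2 + k) * sq q₁ + k * sq q₂) * sq (d₁ * d₂)
    ≡⟨ regroup (2 + k) k q₁ q₂ d₁ d₂ ⟩
  (2 + k) * sq (q₁ * d₁) * sq d₂ + k * sq (q₂ * d₂) * sq d₁
    ≡⟨ cong₂ (λ u v → (2 + k) * sq u * sq d₂ + k * sq v * sq d₁) e₁ e₂ ⟩
  (2 + k) * sq V * sq d₂ + k * sq V * sq d₁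
    ≡⟨ weight-ident k y V ⟩
  2 * suc k * weight (sq (suc k)) y * sq V ∎
  where
  open ≡-Reasoning
  d₁ = 3 + (sq (2 + k) + y)
  d₂ = 3 + (sq k + y)

  prod-ident : ∀ k y → pairProd (sq (suc k)) y ≡ (3 + (sq (2 + k) + y)) * (3 + (sq k + y))
  prod-ident = h
    where
    h : ∀ k y → (suc k * suc k + y) * (suc k * suc k + y) + 4 * (suc k * suc k + y) + 16 + 4 * y
              ≡ (3 + ((2 + k) * (2 + k) + y)) * (3 + (k * k + y))
    h = solve-∀

  regroup : ∀ m k q₁ q₂ d₁ d₂ → (m * sq q₁ + k * sq q₂) * sq (d₁ * d₂)
            ≡ m * sq (q₁ * d₁) * sq d₂ + k * sq (q₂ * d₂) * sq d₁
  regroup = h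
    where
    h : ∀ m k q₁ q₂ d₁ d₂ → (m * (q₁ * q₁) + k * (q₂ * q₂)) * (d₁ * d₂ * (d₁ * d₂))
        ≡ m * (q₁ * d₁ * (q₁ * d₁)) * (d₂ * d₂) + k * (q₂ * d₂ * (q₂ * d₂)) * (d₁ * d₁)
    h = solve-∀

  weight-ident : ∀ k y V → (2 + k) * sq V * sq (3 + (sq k + y)) + k * sq V * sq (3 + (sq (2 + k) + y))
                 ≡ 2 * suc k * weight (sq (suc k)) y * sq V
  weight-ident = h
    where
    h : ∀ k y V → (2 + k) * (V * V) * ((3 + (k * k + y)) * (3 + (k * k + y)))
                  + k * (V * V) * ((3 + ((2 + k) * (2 + k) + y)) * (3 + ((2 + k) * (2 + k) + y)))
        ≡ 2 * suc k * ((suc k * suc k + y + 4) * (suc k * suc k + y) + 4 * (suc k * suc k)) * (V * V)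
    h = solve-∀

module _ (G : ℕ → ℕ → ℕ) where
  pole : ℕ → ℕ → ℕ
  pole a b = a * b * sq (G a b)

  -- The five equations say that `G` is V / (a² + b² + 3) at the centre and its neighbours, so no
  -- quotient has to be handled. Each pair of opposite neighbours is summed by `opposite-pair`.
  pole-superharmonic : ∀ i j {V} →
    G i       (suc j) * (3 + (sq i + sq (suc j))) ≡ V →
    G (2 + i) (suc j) * (3 + (sq (2 + i) + sq (suc j))) ≡ V →
    G (suc i) j       * (3 + (sq (suc i) + sq j)) ≡ V →
    G (suc i) (2 + j) * (3 + (sq (suc i) + sq (2 + j))) ≡ V →
    G (suc i) (suc j) * (3 + (sq (suc i) + sq (suc j))) ≡ V →
    pole i (suc j) + pole (2 + i) (suc j) + pole (suc i) j + pole (suc i) (2 + j)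
      ≤ 4 * pole (suc i) (suc j)
  pole-superharmonic i j {V} e₁ e₂ e₃ e₄ e₀ = *-cancelʳ-≤ _ _ (sq d₀ * (sq DA * sq DB)) (begin
    (i * suc j * sq (G i (suc j)) + (2 + i) * suc j * sq (G (2 + i) (suc j))
      + suc i * j * sq (G (suc i) j) + suc i * (2 + j) * sq (G (suc i) (2 + j))) * (sq d₀ * (sq DA * sq DB))
      ≡⟨ regroup i j (sq (G i (suc j))) (sq (G (2 + i) (suc j))) (sq (G (suc i) j)) (sq (G (suc i) (2 + j)))
           (sq d₀) (sq DA) (sq DB) ⟩
    suc j * (((2 + i) * sq (G (2 + i) (suc j)) + i * sq (G i (suc j))) * sq DA) * (sq d₀ * sq DB)
      + suc i * (((2 + j) * sq (G (suc i) (2 + j)) + j * sq (G (suc i) j)) * sq DB) * (sq d₀ * sq DA)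
      ≡⟨ cong₂ (λ u v → suc j * u * (sq d₀ * sq DB) + suc i * v * (sq d₀ * sq DA))
           (opposite-pair i (sq (suc j)) (G (2 + i) (suc j)) (G i (suc j)) e₂ e₁)
           -- The second pair is the first with the coordinates exchanged, so the squares in its
           -- denominators are swapped.
           (opposite-pair j (sq (suc i)) (G (suc i) (2 + j)) (G (suc i) j) (flip-den (suc i) (2 + j) e₄) (flip-den (suc i) j e₃)) ⟩
    suc j * (2 * suc i * UA * sq V) * (sq d₀ * sq DB) + suc i * (2 * suc j * UB * sq V) * (sq d₀ * sq DA)
      ≡⟨ factor (suc i) (suc j) UA UB (sq V) (sq d₀) (sq DA) (sq DB) ⟩
    2 * suc i * suc j * sq V * (sq d₀ * (UA * sq DB + UB * sq DA))
      ≤⟨ *-monoʳ-≤ (2 * suc i * suc j * sq V) (radial-≤ (sq (suc i)) (sq (suc j))) ⟩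
    2 * suc i * suc j * sq V * (2 * (sq DA * sq DB))
      ≡⟨ cong (λ v → 2 * suc i * suc j * sq v * (2 * (sq DA * sq DB))) e₀ ⟨
    2 * suc i * suc j * sq (G (suc i) (suc j) * d₀) * (2 * (sq DA * sq DB))
      ≡⟨ ungroup (suc i) (suc j) (G (suc i) (suc j)) d₀ (sq DA * sq DB) ⟩
    4 * (suc i * suc j * sq (G (suc i) (suc j))) * (sq d₀ * (sq DA * sq DB)) ∎)
    where
    open ≤-Reasoning
    d₀ = 3 + (sq (suc i) + sq (suc j))
    DA = pairProd (sq (suc i)) (sq (suc j))
    DB = pairProd (sq (suc j)) (sq (suc i))
    UA = weight (sq (suc i)) (sq (suc j))
    UB = weight (sq (suc j)) (sq (suc i))

    flip-den : ∀ a b → G a b * (3 + (sq a + sq b)) ≡ V → G a b * (3 + (sq b + sq a)) ≡ V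
    flip-den a b = trans (cong (λ s → G a b * (3 + s)) (+-comm (sq b) (sq a)))

    regroup : ∀ i j s₁ s₂ s₃ s₄ d A B →
      (i * suc j * s₁ + (2 + i) * suc j * s₂ + suc i * j * s₃ + suc i * (2 + j) * s₄) * (d * (A * B))
      ≡ suc j * (((2 + i) * s₂ + i * s₁) * A) * (d * B) + suc i * (((2 + j) * s₄ + j * s₃) * B) * (d * A)
    regroup = solve-∀

    factor : ∀ a b U W v d A B →
      b * (2 * a * U * v) * (d * B) + a * (2 * b * W * v) * (d * A) ≡ 2 * a * b * v * (d * (U * B + W * A))
    factor = solve-∀

    ungroup : ∀ a b g d D → 2 * a * b * sq (g * d) * (2 * D) ≡ 4 * (a * b * sq g) * (sq d * D)
    ungroup = h
      where
      h : ∀ a b g d D → 2 * a * b * (g * d * (g * d)) * (2 * D) ≡ 4 * (a * b * (g * g)) * (d * d * D)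
      h = solve-∀

-- Gluing two superharmonic functions across the antidiagonal

Potential : Set
Potential = ℕ → ℕ → ℕ

neighbours : Potential → ℕ → ℕ → ℕ
neighbours h i j = h i (suc j) + h (2 + i) (suc j) + h (suc i) j + h (suc i) (2 + j)

neighbours-mono : ∀ {h k : Potential} i j →
  h i (suc j) ≤ k i (suc j) → h (2 + i) (suc j) ≤ k (2 + i) (suc j) →
  h (suc i) j ≤ k (suc i) j → h (suc i) (2 + j) ≤ k (suc i) (2 + j) →
  neighbours h i j ≤ neighbours k i j
neighbours-mono i j l₁ l₂ l₃ l₄ = +-mono-≤ (+-mono-≤ (+-mono-≤ l₁ l₂) l₃) l₄

Superharmonic : ℕ → Potential → Set
Superharmonic n h = ∀ i j → i < n → j < n → neighbours h i j ≤ 4 * h (suc i) (suc j)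

m<n⇒1+m∣n! : ∀ {m n} → suc m ≤ n → suc m ∣ n !
m<n⇒1+m∣n! {m} m<n = ∣-trans (m∣m*n (m !)) (m≤n⇒m!∣n! m<n)

sq-mono : ∀ {a b} → a ≤ b → sq a ≤ sq b
sq-mono a≤b = *-mono-≤ a≤b a≤b

-- The defect is (a - b)²; the order of `a` and `b` is settled first so that the difference exists
-- in ℕ.
sq-+-≤ : ∀ a b → sq (a + b) ≤ 2 * (sq a + sq b)
sq-+-≤ a b with ≤-total a b
... | inj₁ a≤b = subst (λ x → sq (a + x) ≤ 2 * (sq a + sq x)) (m+[n∸m]≡n a≤b) (ordered a (b ∸ a))
  where
  expand : ∀ a d → (a + (a + d)) * (a + (a + d)) + d * d ≡ 2 * (a * a + (a + d) * (a + d))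
  expand = solve-∀
  ordered : ∀ a d → sq (a + (a + d)) ≤ 2 * (sq a + sq (a + d))
  ordered a d = m+n≤o⇒m≤o _ (≤-reflexive (expand a d))
... | inj₂ b≤a = subst (λ x → sq (x + b) ≤ 2 * (sq x + sq b)) (m+[n∸m]≡n b≤a) (ordered b (a ∸ b))
  where
  expand : ∀ b d → (b + d + b) * (b + d + b) + d * d ≡ 2 * ((b + d) * (b + d) + b * b)
  expand = solve-∀
  ordered : ∀ b d → sq (b + d + b) ≤ 2 * (sq (b + d) + sq b)
  ordered b d = m+n≤o⇒m≤o _ (≤-reflexive (expand b d))

∸-step : ∀ {n i} → i < n → n ∸ i ≡ suc (n ∸ suc i)
∸-step {n} {i} i<n = +-∸-assoc 1 i<n

module GridPotential (n : ℕ) where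
  N : ℕ
  N = suc n

  abstract
    -- A common multiple of all denominators `3 + s` met on the grid and the sink lines; it makes
    -- the scaled potentials natural numbers. `abstract` keeps the factorial from unfolding.
    W : ℕ
    W = (3 + (sq N + sq N)) !

    W≢0 : NonZero W
    W≢0 = (3 + (sq N + sq N)) !≢0

    3+s∣W : ∀ {s} → s ≤ sq N + sq N → 3 + s ∣ W
    3+s∣W s≤ = m<n⇒1+m∣n! (+-monoʳ-≤ 3 s≤)

  -- In units of `sq W`, `source` is n⁴ a b / (a² + b² + 3)² and `κ` is the constant 4.
  V κ : ℕ
  V = n * n * W
  κ = sq (2 * W)

  -- The division is exact for s ≤ 2 N², the only range in which recip is used.
  recip : ℕ → ℕ
  recip s = W / (3 + s)

  decay : ℕ → ℕ → ℕ
  decay a b = n * n * recip (sq a + sq b)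

  recip-* : ∀ {a b} → a ≤ N → b ≤ N → recip (sq a + sq b) * (3 + (sq a + sq b)) ≡ W
  recip-* {a} {b} a≤N b≤N = m/n*n≡m (3+s∣W (+-mono-≤ (sq-mono a≤N) (sq-mono b≤N)))

  decay-* : ∀ a b → a ≤ N → b ≤ N → decay a b * (3 + (sq a + sq b)) ≡ V
  decay-* a b a≤N b≤N =
    trans (*-assoc (n * n) (recip (sq a + sq b)) _) (cong (n * n *_) (recip-* {a} {b} a≤N b≤N))

  source : Potential
  source = pole decay

  -- For a, b ≤ N no subtraction truncates, and the function vanishes on the sink lines a = N and b
  -- = N.
  far : Potential
  far a b = κ * ((N ∸ a) * (N ∸ b))

  source-superharmonic : Superharmonic n source
  source-superharmonic i j i<n j<n = pole-superharmonic decay i j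
    (decay-* i (suc j) i≤N sj≤N) (decay-* (2 + i) (suc j) (s≤s i<n) sj≤N)
    (decay-* (suc i) j si≤N j≤N) (decay-* (suc i) (2 + j) si≤N (s≤s j<n))
    (decay-* (suc i) (suc j) si≤N sj≤N)
    where
    si≤N = m≤n⇒m≤1+n i<n
    sj≤N = m≤n⇒m≤1+n j<n
    i≤N = ≤-trans (n≤1+n i) si≤N
    j≤N = ≤-trans (n≤1+n j) sj≤N

  far-harmonic : ∀ i j → i < n → j < n → neighbours far i j ≡ 4 * far (suc i) (suc j)
  far-harmonic i j i<n j<n
    rewrite ∸-step (m<n⇒m<1+n i<n) | ∸-step (m<n⇒m<1+n j<n) | ∸-step i<n | ∸-step j<n
    = expand κ (n ∸ suc i) (n ∸ suc j)
    where
    expand : ∀ c p q → c * (suc (suc p) * suc q) + c * (p * suc q) + c * (suc p * suc (suc q)) + c * (suc p * q)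
             ≡ 4 * (c * (suc p * suc q))
    expand = solve-∀

  glued : Potential
  glued a b with a + b ≤? N
  ... | yes _ = source a b
  ... | no _ = far a b ⊓ source a b

  glued≤source : ∀ a b → glued a b ≤ source a b
  glued≤source a b with a + b ≤? N
  ... | yes _ = ≤-refl
  ... | no _ = m⊓n≤n _ _

  source≡glued : ∀ a b → a + b ≤ N → source a b ≡ glued a b
  source≡glued a b a+b≤N with a + b ≤? N
  ... | yes _ = refl
  ... | no ¬p = contradiction a+b≤N ¬p

  source≤far : ∀ a b → a + b ≡ N → source a b ≤ far a b
  source≤far a b e = begin
    a * b * sq (decay a b)        ≤⟨ *-monoʳ-≤ (a * b) (sq-mono small) ⟩
    a * b * κ                     ≡⟨ *-comm (a * b) κ ⟩
    κ * (a * b)                   ≡⟨ cong (κ *_) (*-comm a b) ⟩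
    κ * (b * a)                   ≡⟨ cong₂ (λ x y → κ * (x * y)) (m+n∸m≡n a b) (m+n∸n≡m a b) ⟨
    κ * ((a + b ∸ a) * (a + b ∸ b)) ≡⟨ cong (λ m → κ * ((m ∸ a) * (m ∸ b))) e ⟩
    far a b                       ∎
    where
    open ≤-Reasoning
    s = sq a + sq b
    -- On the antidiagonal n² ≤ (a + b)² ≤ 2 s, which cancels the denominator 3 + s up to the factor
    -- 2 in `κ`.
    small : decay a b ≤ 2 * W
    small = begin
      n * n * recip s     ≤⟨ *-monoˡ-≤ (recip s) (sq-mono (n≤1+n n)) ⟩
      sq N * recip s      ≡⟨ cong (λ m → sq m * recip s) e ⟨
      sq (a + b) * recip s ≤⟨ *-monoˡ-≤ (recip s) (sq-+-≤ a b) ⟩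
      2 * s * recip s     ≤⟨ *-monoˡ-≤ (recip s) (*-monoʳ-≤ 2 (m≤n+m s 3)) ⟩
      2 * (3 + s) * recip s ≡⟨ *-assoc 2 (3 + s) (recip s) ⟩
      2 * ((3 + s) * recip s) ≡⟨ cong (2 *_) (*-comm (3 + s) (recip s)) ⟩
      2 * (recip s * (3 + s)) ≡⟨ cong (2 *_) (recip-* {a} {b} (m+n≤o⇒m≤o a (≤-reflexive e)) (m+n≤o⇒n≤o a (≤-reflexive e))) ⟩
      2 * W ∎

  glued≤far : ∀ a b → N ≤ a + b → glued a b ≤ far a b
  glued≤far a b N≤a+b with a + b ≤? N
  ... | yes a+b≤N = source≤far a b (≤-antisym a+b≤N N≤a+b)
  ... | no _ = m⊓n≤m _ _

  glued-cases : ∀ a b → glued a b ≡ source a b ⊎ (N < a + b × glued a b ≡ far a b)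
  glued-cases a b with a + b ≤? N
  ... | yes _ = inj₁ refl
  ... | no a+b≰N with ⊓-sel (far a b) (source a b)
  ...   | inj₁ e = inj₂ (≰⇒> a+b≰N , e)
  ...   | inj₂ e = inj₁ e

  -- Whichever function gives the value at the centre also bounds `glued` at all four neighbours:
  -- `source` bounds it everywhere, and `far` from the antidiagonal on, where all neighbours of a
  -- point strictly beyond it lie.
  glued-superharmonic : Superharmonic n glued
  glued-superharmonic i j i<n j<n with glued-cases (suc i) (suc j)
  ... | inj₁ e = begin
    neighbours glued i j  ≤⟨ neighbours-mono {glued} {source} i j (glued≤source i (suc j))
                              (glued≤source (2 + i) (suc j)) (glued≤source (suc i) j) (glued≤source (suc i) (2 + j)) ⟩
    neighbours source i j ≤⟨ source-superharmonic i j i<n j<n ⟩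
    4 * source (suc i) (suc j) ≡⟨ cong (4 *_) e ⟨
    4 * glued (suc i) (suc j) ∎
    where open ≤-Reasoning
  ... | inj₂ (beyond , e) = begin
    neighbours glued i j  ≤⟨ neighbours-mono {glued} {far} i j
                              (glued≤far i (suc j) N≤lower)
                              (glued≤far (2 + i) (suc j) (m≤n⇒m≤1+n (<⇒≤ beyond)))
                              (glued≤far (suc i) j (≤-trans N≤lower (≤-reflexive (+-suc i j))))
                              (glued≤far (suc i) (2 + j) (≤-trans (<⇒≤ beyond) (+-monoʳ-≤ (suc i) (n≤1+n (suc j))))) ⟩
    neighbours far i j    ≡⟨ far-harmonic i j i<n j<n ⟩
    4 * far (suc i) (suc j) ≡⟨ cong (4 *_) e ⟨
    4 * glued (suc i) (suc j) ∎
    where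
    open ≤-Reasoning
    N≤lower : N ≤ i + suc j
    N≤lower = s≤s⁻¹ beyond

  glued-far-corner : 1 ≤ n → glued n n ≤ κ
  glued-far-corner 1≤n = begin
    glued n n               ≤⟨ glued≤far n n (+-monoˡ-≤ n 1≤n) ⟩
    κ * ((N ∸ n) * (N ∸ n)) ≡⟨ cong (λ d → κ * (d * d)) (m+n∸n≡m 1 n) ⟩
    κ * 1                   ≡⟨ *-identityʳ κ ⟩
    κ                       ∎
    where open ≤-Reasoning

  -- At `p` and `q` the denominator is at most 3 + 1 + 4 = 8, whence 64 = 8²; `2 ≤ n` puts both
  -- points on the side where `glued` is `source`.
  glued-near-corner : ∀ a b → 1 ≤ a → 1 ≤ b → a + b ≤ 3 → 2 ≤ n → sq V ≤ 64 * glued a b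
  glued-near-corner (suc a) (suc b) _ _ a+b≤3 2≤n = begin
    sq V  ≡⟨ cong sq (decay-* (suc a) (suc b) (m+n≤o⇒m≤o (suc a) in-square) (m+n≤o⇒n≤o (suc a) in-square)) ⟨
    sq (decay (suc a) (suc b) * d) ≤⟨ sq-mono (*-monoʳ-≤ (decay (suc a) (suc b)) (d≤8 a b a+b≤3)) ⟩
    sq (decay (suc a) (suc b) * 8) ≡⟨ expand (decay (suc a) (suc b)) ⟩
    64 * sq (decay (suc a) (suc b)) ≤⟨ *-monoʳ-≤ 64 (m≤n*m (sq (decay (suc a) (suc b))) (suc a * suc b)) ⟩
    64 * source (suc a) (suc b) ≡⟨ cong (64 *_) (source≡glued (suc a) (suc b) in-square) ⟩
    64 * glued (suc a) (suc b) ∎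
    where
    open ≤-Reasoning
    d = 3 + (sq (suc a) + sq (suc b))
    in-square : suc a + suc b ≤ N
    in-square = ≤-trans a+b≤3 (s≤s 2≤n)
    d≤8 : ∀ a b → suc a + suc b ≤ 3 → 3 + (sq (suc a) + sq (suc b)) ≤ 8
    d≤8 zero zero _ = m≤n⇒m≤n+o 3 ≤-refl
    d≤8 zero (suc zero) _ = ≤-refl
    d≤8 (suc zero) zero _ = ≤-refl
    d≤8 zero (suc (suc b)) (s≤s (s≤s (s≤s ())))
    d≤8 (suc zero) (suc b) (s≤s (s≤s (s≤s ())))
    d≤8 (suc (suc a)) b (s≤s (s≤s (s≤s p))) with () ← ≤-trans (m≤n+m (suc b) a) p
    expand : ∀ g → g * 8 * (g * 8) ≡ 64 * (g * g)
    expand = solve-∀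

-- A strictly superharmonic function, used for termination; curvature in one coordinate suffices.
paraboloid : ℕ → Potential
paraboloid n a b = sq (suc n) ∸ sq a

paraboloid-strict : ∀ n i j → i < n → neighbours (paraboloid n) i j < 4 * paraboloid n (suc i) (suc j)
-- With `sq (suc n)` written as `m + sq (2 + i)` every subtraction is exact, and the two sides
-- differ by 2.
paraboloid-strict n i j i<n = subst strict (m∸n+n≡m (sq-mono (s≤s i<n))) (shifted (sq (suc n) ∸ sq (2 + i)))
  where
  strict : ℕ → Set
  strict q = (q ∸ sq i) + (q ∸ sq (2 + i)) + (q ∸ sq (suc i)) + (q ∸ sq (suc i)) < 4 * (q ∸ sq (suc i))
  split₁ : ∀ m i → m + (2 + i) * (2 + i) ≡ m + 2 * i + 3 + suc i * suc i
  split₁ = solve-∀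
  split₂ : ∀ m i → m + (2 + i) * (2 + i) ≡ m + 4 * i + 4 + i * i
  split₂ = solve-∀
  count : ∀ m i → suc (m + 4 * i + 4 + m + (m + 2 * i + 3) + (m + 2 * i + 3)) + 1 ≡ 4 * (m + 2 * i + 3)
  count = solve-∀
  shifted : ∀ m → strict (m + sq (2 + i))
  shifted m
    rewrite m+n∸n≡m m (sq (2 + i))
          | trans (cong (_∸ sq (suc i)) (split₁ m i)) (m+n∸n≡m (m + 2 * i + 3) (sq (suc i)))
          | trans (cong (_∸ sq i) (split₂ m i)) (m+n∸n≡m (m + 4 * i + 4) (sq i))
    = m+n≤o⇒m≤o _ (≤-reflexive (count m i))

-- Energy and stabilisation

sum-mono : ∀ {n} {f g : Fin n → ℕ} → (∀ i → f i ≤ g i) → sum f ≤ sum g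
sum-mono {zero} f≤g = z≤n
sum-mono {suc n} f≤g = +-mono-≤ (f≤g zero) (sum-mono (f≤g ∘ suc))

term≤sum : ∀ {n} (f : Fin n → ℕ) i → f i ≤ sum f
term≤sum f zero = m≤m+n _ _
term≤sum f (suc i) = ≤-trans (term≤sum (f ∘ suc) i) (m≤n+m _ (f zero))

sum-zero : ∀ {n} {f : Fin n → ℕ} → (∀ i → f i ≡ 0) → sum f ≡ 0
sum-zero {zero} f≡0 = refl
sum-zero {suc n} f≡0 = cong₂ _+_ (f≡0 zero) (sum-zero (f≡0 ∘ suc))

-- If `a` is 0 or exceeds `n`, no index matches and the sum is 0: this is how neighbours in the sink
-- drop out of the energy.
sum-concentrated : ∀ {n} {f : Fin n → ℕ} (a : ℕ) {c} →
  (∀ i → a ≡ suc (toℕ i) → f i ≤ c) → (∀ i → a ≢ suc (toℕ i) → f i ≡ 0) → sum f ≤ c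
sum-concentrated {zero} a here there = z≤n
sum-concentrated {suc n} zero here there = ≤-trans (≤-reflexive (sum-zero λ i → there i (λ ()))) z≤n
sum-concentrated {suc n} {f} (suc zero) {c} here there = begin
  f zero + sum (f ∘ suc) ≡⟨ cong (f zero +_) (sum-zero λ i → there (suc i) (λ ())) ⟩
  f zero + 0 ≡⟨ +-identityʳ _ ⟩
  f zero ≤⟨ here zero refl ⟩
  c ∎
  where open ≤-Reasoning
sum-concentrated {suc n} {f} (suc (suc a)) {c} here there = begin
  f zero + sum (f ∘ suc) ≡⟨ cong (_+ sum (f ∘ suc)) (there zero (λ ())) ⟩
  sum (f ∘ suc) ≤⟨ sum-concentrated (suc a) (λ i e → here (suc i) (cong suc e)) (λ i ne → there (suc i) (ne ∘ suc-injective)) ⟩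
  c ∎
  where open ≤-Reasoning

total : ∀ {n} → Config n → ℕ
total f = sum λ i → sum λ j → f (i , j)

total-mono : ∀ {n} {f g : Config n} → (∀ x → f x ≤ g x) → total f ≤ total g
total-mono f≤g = sum-mono λ i → sum-mono λ j → f≤g (i , j)

total-+ : ∀ {n} (f g : Config n) → total (λ x → f x + g x) ≡ total f + total g
total-+ f g = trans (sum-cong-≗ λ i → ∑-distrib-+ (λ j → f (i , j)) (λ j → g (i , j)))
                    (∑-distrib-+ (λ i → sum λ j → f (i , j)) (λ i → sum λ j → g (i , j)))

term≤total : ∀ {n} (f : Config n) x → f x ≤ total f
term≤total f (i , j) = ≤-trans (term≤sum (λ j → f (i , j)) j) (term≤sum (λ i → sum λ j → f (i , j)) i)

-- Indicators and the balance of a single toppling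

bit : Bool → ℕ
bit b = if b then 1 else 0

bit-∨ : ∀ a b → bit (a ∨ b) ≤ bit a + bit b
bit-∨ true b = s≤s z≤n
bit-∨ false b = ≤-refl

≡ᵇ-comm : ∀ m n → (m ≡ᵇ n) ≡ (n ≡ᵇ m)
≡ᵇ-comm zero zero = refl
≡ᵇ-comm zero (suc n) = refl
≡ᵇ-comm (suc m) zero = refl
≡ᵇ-comm (suc m) (suc n) = ≡ᵇ-comm m n

≡ᵇ-refl : ∀ m → (m ≡ᵇ m) ≡ true
≡ᵇ-refl zero = refl
≡ᵇ-refl (suc m) = ≡ᵇ-refl m

≢⇒≡ᵇ-false : ∀ {m n} → m ≢ n → (m ≡ᵇ n) ≡ false
≢⇒≡ᵇ-false {m} {n} m≢n with m ≡ᵇ n in e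
... | true = contradiction (≡ᵇ⇒≡ m n (Equivalence.from T-≡ e)) m≢n
... | false = refl

eqV-refl : ∀ {n} (v : Vertex n) → eqV v v ≡ true
eqV-refl (i , j) rewrite ≡ᵇ-refl (toℕ i) = ≡ᵇ-refl (toℕ j)

eqV⇒≡ : ∀ {n} (v x : Vertex n) → eqV v x ≡ true → v ≡ x
eqV⇒≡ (i , j) (k , l) e with Equivalence.to T-∧ (Equivalence.from T-≡ e)
... | i≡k , j≡l = cong₂ _,_ (toℕ-injective (≡ᵇ⇒≡ _ _ i≡k)) (toℕ-injective (≡ᵇ⇒≡ _ _ j≡l))

-- Lattice points (a , b) carry 1-based coordinates, so that the lines 0 and n + 1 are the sink.
at : ∀ {n} → ℕ → ℕ → Config n
at a b (k , l) = bit ((a ≡ᵇ suc (toℕ k)) ∧ (b ≡ᵇ suc (toℕ l)))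

value : ∀ {n} → Potential → Config n
value h (i , j) = h (suc (toℕ i)) (suc (toℕ j))

atNeighbours : ∀ {n} → ℕ → ℕ → Config n
atNeighbours i j x = at i (suc j) x + at (2 + i) (suc j) x + at (suc i) j x + at (suc i) (2 + j) x

adj≤atNeighbours : ∀ {n} (i j : Fin n) x → bit (adj (i , j) x) ≤ atNeighbours (toℕ i) (toℕ j) x
adj≤atNeighbours i j (k , l) = begin
  bit ((sameRow ∧ diff1 (toℕ j) (toℕ l)) ∨ (sameCol ∧ diff1 (toℕ i) (toℕ k)))
    ≤⟨ bit-∨ (sameRow ∧ diff1 (toℕ j) (toℕ l)) (sameCol ∧ diff1 (toℕ i) (toℕ k)) ⟩
  bit (sameRow ∧ diff1 (toℕ j) (toℕ l)) + bit (sameCol ∧ diff1 (toℕ i) (toℕ k))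
    ≤⟨ +-mono-≤ (split sameRow (suc (toℕ j) ≡ᵇ toℕ l) _) (split sameCol (suc (toℕ i) ≡ᵇ toℕ k) _) ⟩
  (bit (sameRow ∧ (suc (toℕ j) ≡ᵇ toℕ l)) + bit (sameRow ∧ (suc (toℕ l) ≡ᵇ toℕ j))) +
  (bit (sameCol ∧ (suc (toℕ i) ≡ᵇ toℕ k)) + bit (sameCol ∧ (suc (toℕ k) ≡ᵇ toℕ i)))
    ≡⟨ cong₂ _+_
         (cong (λ p → bit (sameRow ∧ (suc (toℕ j) ≡ᵇ toℕ l)) + bit (sameRow ∧ p)) (≡ᵇ-comm (suc (toℕ l)) (toℕ j)))
         (cong₂ (λ p q → bit p + bit q) (∧-comm sameCol _)
           (trans (cong (sameCol ∧_) (≡ᵇ-comm (suc (toℕ k)) (toℕ i))) (∧-comm sameCol _))) ⟩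
  (E₄ + E₃) + (E₂ + E₁) ≡⟨ rearrange E₁ E₂ E₃ E₄ ⟩
  E₁ + E₂ + E₃ + E₄ ∎
  where
  open ≤-Reasoning
  sameRow = toℕ i ≡ᵇ toℕ k
  sameCol = toℕ j ≡ᵇ toℕ l
  E₁ = at (toℕ i) (suc (toℕ j)) (k , l)
  E₂ = at (2 + toℕ i) (suc (toℕ j)) (k , l)
  E₃ = at (suc (toℕ i)) (toℕ j) (k , l)
  E₄ = at (suc (toℕ i)) (2 + toℕ j) (k , l)
  split : ∀ p q r → bit (p ∧ (q ∨ r)) ≤ bit (p ∧ q) + bit (p ∧ r)
  split p q r = ≤-trans (≤-reflexive (cong bit (∧-distribˡ-∨ p q r))) (bit-∨ (p ∧ q) (p ∧ r))
  rearrange : ∀ a b c d → (d + c) + (b + a) ≡ a + b + c + d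
  rearrange = solve-∀

topple-balance : ∀ {n} (σ : Config n) v → deg ≤ σ v → ∀ x →
  topple v σ x + 4 * bit (eqV v x) ≤ σ x + bit (adj v x)
topple-balance σ v 4≤σv x with eqV v x in e
... | true = ≤-trans (≤-reflexive (m∸n+n≡m (subst (λ y → deg ≤ σ y) (eqV⇒≡ v x e) 4≤σv))) (m≤m+n _ _)
... | false with adj v x
...   | true = ≤-reflexive (trans (+-identityʳ _) (+-comm 1 (σ x)))
...   | false = ≤-refl

addGrain-balance : ∀ {n} v (σ : Config n) x → addGrain v σ x ≡ σ x + bit (eqV v x)
addGrain-balance v σ x with eqV v x
... | true = +-comm 1 (σ x)
... | false = sym (+-identityʳ _)

module Energy {n : ℕ} (h : Potential) where
  energy : Config n → ℕ
  energy σ = total λ x → σ x * value h x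

  energy-mono : ∀ {σ τ} → (∀ x → σ x ≤ τ x) → energy σ ≤ energy τ
  energy-mono σ≤τ = total-mono λ x → *-monoˡ-≤ (value h x) (σ≤τ x)

  energy-+ : ∀ σ τ → energy (λ x → σ x + τ x) ≡ energy σ + energy τ
  energy-+ σ τ = trans (total-cong λ x → *-distribʳ-+ (value h x) (σ x) (τ x))
                       (total-+ (λ x → σ x * value h x) (λ x → τ x * value h x))
    where
    total-cong : ∀ {f g : Config n} → (∀ x → f x ≡ g x) → total f ≡ total g
    total-cong f≗g = sum-cong-≗ λ i → sum-cong-≗ λ j → f≗g (i , j)

  energy-empty : energy empty ≡ 0
  energy-empty = sum-zero {n} λ i → sum-zero {n} λ j → refl

  grain≤energy : ∀ σ x → 1 ≤ σ x → value h x ≤ energy σ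
  grain≤energy σ x 1≤σx = begin
    value h x       ≡⟨ *-identityˡ _ ⟨
    1 * value h x   ≤⟨ *-monoˡ-≤ (value h x) 1≤σx ⟩
    σ x * value h x ≤⟨ term≤total (λ x → σ x * value h x) x ⟩
    energy σ        ∎
    where open ≤-Reasoning

  -- Only an inequality, since a point of the sink carries no energy while `h` may be positive
  -- there.
  energy-at : ∀ a b → energy (at a b) ≤ h a b
  energy-at a b = sum-concentrated {n} a
    (λ k a≡k → sum-concentrated {n} b
      (λ l b≡l → ≤-trans (*-monoˡ-≤ (value h (k , l)) (bit≤1 ((a ≡ᵇ suc (toℕ k)) ∧ (b ≡ᵇ suc (toℕ l)))))
        (≤-reflexive (trans (*-identityˡ _) (cong₂ h (sym a≡k) (sym b≡l)))))
      (λ l b≢l → cong (λ p → bit p * value h (k , l))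
        (trans (cong ((a ≡ᵇ suc (toℕ k)) ∧_) (≢⇒≡ᵇ-false b≢l)) (∧-comm (a ≡ᵇ suc (toℕ k)) false))))
    (λ k a≢k → sum-zero λ l →
      cong (λ p → bit (p ∧ (b ≡ᵇ suc (toℕ l))) * value h (k , l)) (≢⇒≡ᵇ-false a≢k))
    where
    bit≤1 : ∀ p → bit p ≤ 1
    bit≤1 true = ≤-refl
    bit≤1 false = z≤n

  energy-atNeighbours : ∀ i j → energy (atNeighbours i j) ≤ neighbours h i j
  energy-atNeighbours i j = begin
    energy (atNeighbours i j)
      ≡⟨ energy-+ (λ x → at i (suc j) x + at (2 + i) (suc j) x + at (suc i) j x) (at (suc i) (2 + j)) ⟩
    energy (λ x → at i (suc j) x + at (2 + i) (suc j) x + at (suc i) j x) + energy (at (suc i) (2 + j))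
      ≡⟨ cong (_+ energy (at (suc i) (2 + j)))
           (energy-+ (λ x → at i (suc j) x + at (2 + i) (suc j) x) (at (suc i) j)) ⟩
    energy (λ x → at i (suc j) x + at (2 + i) (suc j) x) + energy (at (suc i) j) + energy (at (suc i) (2 + j))
      ≡⟨ cong (λ e → e + energy (at (suc i) j) + energy (at (suc i) (2 + j)))
           (energy-+ (at i (suc j)) (at (2 + i) (suc j))) ⟩
    energy (at i (suc j)) + energy (at (2 + i) (suc j)) + energy (at (suc i) j) + energy (at (suc i) (2 + j))
      ≤⟨ +-mono-≤ (+-mono-≤ (+-mono-≤ (energy-at i (suc j)) (energy-at (2 + i) (suc j)))
           (energy-at (suc i) j)) (energy-at (suc i) (2 + j)) ⟩
    neighbours h i j ∎
    where open ≤-Reasoning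

  energy-addGrain : ∀ σ v → energy (addGrain v σ) ≤ energy σ + value h v
  energy-addGrain σ v@(i , j) = begin
    energy (addGrain v σ)                  ≤⟨ energy-mono (λ x → ≤-reflexive (addGrain-balance v σ x)) ⟩
    energy (λ x → σ x + bit (eqV v x))     ≡⟨ energy-+ σ (λ x → bit (eqV v x)) ⟩
    energy σ + energy (at (suc (toℕ i)) (suc (toℕ j))) ≤⟨ +-monoʳ-≤ (energy σ) (energy-at _ _) ⟩
    energy σ + value h v                   ∎
    where open ≤-Reasoning

  -- The energy lost at the toppled vertex stays on the left, so that the change is stated without
  -- subtraction.
  energy-topple : ∀ σ i j → deg ≤ σ (i , j) →
    energy (topple (i , j) σ) + 4 * value h (i , j) ≤ energy σ + neighbours h (toℕ i) (toℕ j)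
  energy-topple σ i j 4≤σv = begin
    energy (topple v σ) + 4 * value h v
      ≤⟨ +-monoʳ-≤ (energy (topple v σ)) (≤-trans (≤-reflexive (cong (λ p → 4 * bit p * value h v) (sym (eqV-refl v))))
           (term≤total (λ x → 4 * bit (eqV v x) * value h x) v)) ⟩
    energy (topple v σ) + energy (λ x → 4 * bit (eqV v x))
      ≡⟨ energy-+ (topple v σ) (λ x → 4 * bit (eqV v x)) ⟨
    energy (λ x → topple v σ x + 4 * bit (eqV v x))
      ≤⟨ energy-mono (λ x → ≤-trans (topple-balance σ v 4≤σv x) (+-monoʳ-≤ (σ x) (adj≤atNeighbours i j x))) ⟩
    energy (λ x → σ x + atNeighbours (toℕ i) (toℕ j) x)
      ≡⟨ energy-+ σ (atNeighbours (toℕ i) (toℕ j)) ⟩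
    energy σ + energy (atNeighbours (toℕ i) (toℕ j))
      ≤⟨ +-monoʳ-≤ (energy σ) (energy-atNeighbours (toℕ i) (toℕ j)) ⟩
    energy σ + neighbours h (toℕ i) (toℕ j) ∎
    where
    open ≤-Reasoning
    v = i , j

  module _ (superharmonic : Superharmonic n h) where
    energy-topplings : ∀ {σ τ} → Star Topple σ τ → energy τ ≤ energy σ
    energy-topplings ε = ≤-refl
    energy-topplings (topple-at σ (i , j) 4≤σv ◅ rest) = ≤-trans (energy-topplings rest)
      (+-cancelʳ-≤ _ _ _ (≤-trans (energy-topple σ i j 4≤σv)
        (+-monoʳ-≤ (energy σ) (superharmonic (toℕ i) (toℕ j) (toℕ<n i) (toℕ<n j)))))

    energy-process : ∀ {σ τ} t v → Process σ (replicate t v) τ → energy τ ≤ energy σ + t * value h v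
    energy-process zero v (done σ) = m≤m+n _ _
    energy-process {σ} (suc t) v (step {τ = ρ} {τ} _ _ (topplings , _) rest) = begin
      energy τ                              ≤⟨ energy-process t v rest ⟩
      energy ρ + t * value h v              ≤⟨ +-monoˡ-≤ _ (energy-topplings topplings) ⟩
      energy (addGrain v σ) + t * value h v ≤⟨ +-monoˡ-≤ _ (energy-addGrain σ v) ⟩
      energy σ + value h v + t * value h v  ≡⟨ +-assoc (energy σ) _ _ ⟩
      energy σ + suc t * value h v          ∎
      where open ≤-Reasoning

stabilize : ∀ {n} (σ : Config n) → ∃ (Stabilizes σ)
-- The paraboloid energy drops at every toppling, so it bounds their number.
stabilize {n} σ₀ = go (suc (energy σ₀)) σ₀ ≤-refl
  where
  open Energy {n} (paraboloid n)
  go : ∀ fuel σ → energy σ < fuel → ∃ (Stabilizes σ)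
  go (suc fuel) σ e<fuel with any? (λ i → any? λ j → deg ≤? σ (i , j))
  ... | no none = σ , ε , λ (i , j) → ≰⇒> λ 4≤σv → none (i , j , 4≤σv)
  ... | yes (i , j , 4≤σv) with go fuel (topple (i , j) σ) (<-≤-trans decreases (s≤s⁻¹ e<fuel))
    where
    decreases : energy (topple (i , j) σ) < energy σ
    decreases = +-cancelʳ-< _ _ _ (≤-<-trans (energy-topple σ i j 4≤σv)
      (+-monoʳ-< (energy σ) (paraboloid-strict n (toℕ i) (toℕ j) (toℕ<n i))))
  ...   | τ , topplings , stable = τ , topple-at σ (i , j) 4≤σv ◅ topplings , stable

-- `NecessarilyRecurrentAfter` speaks only about processes that are given; this provides one to
-- apply it to.
run : ∀ {n} (σ : Config n) vs → ∃ (Process σ vs)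
run σ [] = σ , done σ
run σ (v ∷ vs) with stabilize (addGrain v σ)
... | τ , s with run τ vs
...   | ρ , p = ρ , step v vs s p

-- Recurrence

diff1-irrefl : ∀ a → diff1 a a ≡ false
diff1-irrefl zero = refl
diff1-irrefl (suc a) = diff1-irrefl a

adj-irrefl : ∀ {n} (v : Vertex n) → adj v v ≡ false
adj-irrefl (i , j) rewrite diff1-irrefl (toℕ i) | diff1-irrefl (toℕ j)
  | ∧-zeroʳ (toℕ i ≡ᵇ toℕ i) | ∧-zeroʳ (toℕ j ≡ᵇ toℕ j) = refl

diff1-down : ∀ {n} (i : Fin n) → diff1 (toℕ (suc i)) (toℕ (inject₁ i)) ≡ true
diff1-down i rewrite toℕ-inject₁ i | ≡ᵇ-refl (toℕ i) = ∨-zeroʳ _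

adj-down : ∀ {n} (i : Fin n) j → adj (suc i , j) (inject₁ i , j) ≡ true
adj-down i j rewrite diff1-down i | ≡ᵇ-refl (toℕ j) = ∨-zeroʳ _

adj-left : ∀ {n} i (j : Fin n) → adj (i , suc j) (i , inject₁ j) ≡ true
adj-left i j rewrite diff1-down j | ≡ᵇ-refl (toℕ i) = refl

-- The reverse of `topple-balance`: at `v` itself truncated subtraction can only enlarge the right
-- side, and `v` is not its own neighbour.
topple-gain : ∀ {n} (σ : Config n) v x → σ x + bit (adj v x) ≤ topple v σ x + 4 * bit (eqV v x)
topple-gain σ v x with eqV v x in e
... | true = begin
  σ x + bit (adj v x) ≡⟨ cong (λ b → σ x + bit b) (trans (cong (λ u → adj u x) (eqV⇒≡ v x e)) (adj-irrefl x)) ⟩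
  σ x + 0     ≡⟨ +-identityʳ (σ x) ⟩
  σ x         ≤⟨ m≤n+m∸n (σ x) 4 ⟩
  4 + (σ x ∸ 4) ≡⟨ +-comm 4 _ ⟩
  σ x ∸ 4 + 4 ∎
  where open ≤-Reasoning
... | false with adj v x
...   | true = ≤-reflexive (trans (+-comm (σ x) 1) (sym (+-identityʳ _)))
...   | false = ≤-refl

topple-gain-elsewhere : ∀ {n} (σ : Config n) v x → eqV v x ≡ false → σ x + bit (adj v x) ≤ topple v σ x
topple-gain-elsewhere σ v x e = ≤-trans (topple-gain σ v x)
  (≤-reflexive (trans (cong (λ b → topple v σ x + 4 * bit b) e) (+-identityʳ _)))

-- `toppled` counts the topplings at each vertex. The balance keeps the inflow from one neighbour
-- `y` at a time, which is enough to pass from a vertex to the next along an edge.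
record Odometer {n} (σ τ added : Config n) (p : Vertex n) : Set where
  field
    toppled : Config n
    balance : ∀ x y → σ x + added x + bit (adj y x) * toppled y ≤ τ x + 4 * toppled x
    silent  : toppled p ≡ 0

module _ {n : ℕ} where
  p q : Vertex (2 + n)
  p = zero , zero
  q = zero , suc zero

  Occupied : Config (2 + n) → Set
  Occupied σ = 1 ≤ σ p + σ q

  -- When p topples, q receives a grain, and from then on p and q are never both empty,
  -- since each of them feeds the other when it topples.
  record Ledger (σ τ added : Config (2 + n)) : Set where
    field
      keeps   : Occupied σ → Occupied τ
      outcome : Occupied τ ⊎ Odometer σ τ added p
  open Ledger

  idle : ∀ σ → Ledger σ σ empty
  idle σ .keeps o = o
  idle σ .outcome = inj₂ record
    { toppled = empty
    ; balance = λ x y → ≤-reflexive (cong₂ _+_ (+-identityʳ (σ x)) (*-zeroʳ (bit (adj y x))))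
    ; silent = refl }

  infixr 5 _then_
  _then_ : ∀ {σ ρ τ a b} → Ledger σ ρ a → Ledger ρ τ b → Ledger σ τ (λ x → a x + b x)
  (L then M) .keeps = keeps M ∘ keeps L
  _then_ {σ} {ρ} {τ} {a} {b} L M .outcome with outcome L | outcome M
  ... | _       | inj₁ o = inj₁ o
  ... | inj₁ o  | inj₂ _ = inj₁ (keeps M o)
  ... | inj₂ f  | inj₂ g = inj₂ record
    { toppled = λ x → F.toppled x + G.toppled x
    -- Adding the two balances puts the intermediate `ρ x` on both sides, where it cancels.
    ; balance = λ x y → +-cancelˡ-≤ (ρ x) _ _ (begin
        ρ x + (σ x + (a x + b x) + bit (adj y x) * (F.toppled y + G.toppled y))
          ≡⟨ regroup (ρ x) (σ x) (a x) (b x) (bit (adj y x)) (F.toppled y) (G.toppled y) ⟩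
        (σ x + a x + bit (adj y x) * F.toppled y) + (ρ x + b x + bit (adj y x) * G.toppled y)
          ≤⟨ +-mono-≤ (F.balance x y) (G.balance x y) ⟩
        (ρ x + 4 * F.toppled x) + (τ x + 4 * G.toppled x)
          ≡⟨ ungroup (ρ x) (τ x) (F.toppled x) (G.toppled x) ⟩
        ρ x + (τ x + 4 * (F.toppled x + G.toppled x)) ∎)
    ; silent = cong₂ _+_ F.silent G.silent }
    where
    module F = Odometer f
    module G = Odometer g
    open ≤-Reasoning
    regroup : ∀ r s a b c f g → r + (s + (a + b) + c * (f + g)) ≡ (s + a + c * f) + (r + b + c * g)
    regroup = solve-∀
    ungroup : ∀ r t f g → (r + 4 * f) + (t + 4 * g) ≡ r + (t + 4 * (f + g))
    ungroup = solve-∀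

  one-topple : ∀ σ v → Ledger σ (topple v σ) empty
  one-topple σ v with eqV v p in vp | eqV v q in vq
  ... | true | _ = record { keeps = λ _ → occupied ; outcome = inj₁ occupied }
    where
    occupied : Occupied (topple v σ)
    occupied = subst (λ u → Occupied (topple u σ)) (sym (eqV⇒≡ v p vp))
      (≤-trans (≤-trans (m≤n+m 1 (σ q)) (topple-gain-elsewhere σ p q refl)) (m≤n+m _ _))
  ... | false | true = record { keeps = λ _ → occupied ; outcome = inj₁ occupied }
    where
    occupied : Occupied (topple v σ)
    occupied = subst (λ u → Occupied (topple u σ)) (sym (eqV⇒≡ v q vq))
      (≤-trans (≤-trans (m≤n+m 1 (σ p)) (topple-gain-elsewhere σ q p refl)) (m≤m+n _ _))
  ... | false | false = record
    { keeps = λ o → ≤-trans o (+-mono-≤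
        (m+n≤o⇒m≤o (σ p) (topple-gain-elsewhere σ v p vp)) (m+n≤o⇒m≤o (σ q) (topple-gain-elsewhere σ v q vq)))
    ; outcome = inj₂ record
      { toppled = λ x → bit (eqV v x)
      ; balance = balance
      ; silent = cong bit vp } }
    where
    balance : ∀ x y → σ x + 0 + bit (adj y x) * bit (eqV v y) ≤ topple v σ x + 4 * bit (eqV v x)
    balance x y rewrite +-identityʳ (σ x) with eqV v y in vy
    ... | true = subst (λ u → σ x + bit (adj u x) * 1 ≤ topple v σ x + 4 * bit (eqV v x)) (eqV⇒≡ v y vy)
      (subst (λ b → σ x + b ≤ topple v σ x + 4 * bit (eqV v x)) (sym (*-identityʳ (bit (adj v x)))) (topple-gain σ v x))
    ... | false = subst (λ b → σ x + b ≤ topple v σ x + 4 * bit (eqV v x)) (sym (*-zeroʳ (bit (adj y x))))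
      (≤-trans (+-monoʳ-≤ (σ x) z≤n) (topple-gain σ v x))

  one-grain : ∀ σ v → Ledger σ (addGrain v σ) (λ x → bit (eqV v x))
  one-grain σ v = record
    { keeps = λ o → ≤-trans o (+-mono-≤ (grows p) (grows q))
    ; outcome = inj₂ record
      { toppled = empty
      ; balance = λ x y → ≤-reflexive (cong₂ _+_ (sym (addGrain-balance v σ x)) (*-zeroʳ (bit (adj y x))))
      ; silent = refl } }
    where
    grows : ∀ x → σ x ≤ addGrain v σ x
    grows x = m+n≤o⇒m≤o _ (≤-reflexive (sym (addGrain-balance v σ x)))

  topplings-ledger : ∀ {σ τ} → Star Topple σ τ → ∃ (Ledger σ τ)
  topplings-ledger ε = -, idle _
  topplings-ledger (topple-at σ v _ ◅ rest) = -, (one-topple σ v then topplings-ledger rest .proj₂)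

  process-ledger : ∀ {σ τ vs} → Process σ vs τ → ∃ (Ledger σ τ)
  process-ledger (done σ) = -, idle σ
  process-ledger (step {σ} v _ (topplings , _) rest) =
    -, (one-grain σ v then topplings-ledger topplings .proj₂ then process-ledger rest .proj₂)

  -- Connectedness of the grid: first along the line of `p` with second coordinate zero, then
  -- across.
  spread : (P : Vertex (2 + n) → Set) → P p → (∀ x y → adj y x ≡ true → P x → P y) → ∀ x → P x
  spread P Pp next (i , j) = <-weakInduction (λ j → P (i , j))
    (<-weakInduction (λ i → P (i , zero)) Pp (λ i → next _ _ (adj-down i zero)) i)
    (λ j → next _ _ (adj-left i j)) j

  -- If a run returns to `σ` without toppling `p`, then `σ` cancels from the balance, and a vertex
  -- that never topples receives nothing. Its neighbours then never topple either, so by `spread`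
  -- nothing topples, and the grain added at `v` cannot have left.
  recurrent⇒occupied : ∀ {σ} → Recurrent σ → Occupied σ
  recurrent⇒occupied {σ} (v , _ , τ , step {σ} v _ (topplings , _) rest , τ≗σ)
    with outcome (one-grain σ v then topplings-ledger topplings .proj₂ then process-ledger rest .proj₂)
  ... | inj₁ o = subst (1 ≤_) (cong₂ _+_ (τ≗σ p) (τ≗σ q)) o
  ... | inj₂ od = contradiction (m+n≡0⇒m≡0 _ (m+n≡0⇒m≡0 _ (n≤0⇒n≡0 (flow v v (quiet v)))))
      (λ e → contradiction (trans (cong bit (sym (eqV-refl v))) e) λ ())
    where
    open Odometer od
    added : Config (2 + n)
    added x = bit (eqV v x) + (topplings-ledger topplings .proj₁ x + process-ledger rest .proj₁ x)
    flow : ∀ x y → toppled x ≡ 0 → added x + bit (adj y x) * toppled y ≤ 0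
    flow x y tx = +-cancelˡ-≤ (σ x) _ _ (begin
      σ x + (added x + bit (adj y x) * toppled y) ≡⟨ +-assoc (σ x) _ _ ⟨
      σ x + added x + bit (adj y x) * toppled y ≤⟨ balance x y ⟩
      τ x + 4 * toppled x ≡⟨ cong₂ (λ s t → s + 4 * t) (τ≗σ x) tx ⟩
      σ x + 0 ∎)
      where open ≤-Reasoning
    quiet : ∀ x → toppled x ≡ 0
    quiet = spread (λ x → toppled x ≡ 0) silent λ x y yx tx →
      trans (sym (+-identityʳ _)) (m+n≡0⇒n≡0 (added x) (n≤0⇒n≡0
        (subst (λ b → added x + bit b * toppled y ≤ 0) yx (flow x y tx))))

-- The quartic lower bound

sq-V : ∀ n w → n * (n * (n * (n * 1))) * (w * w) ≡ n * n * w * (n * n * w)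
sq-V = solve-∀

collect-κ : ∀ t w → 64 * (t * (2 * w * (2 * w))) ≡ 256 * t * (w * w)
collect-κ = solve-∀

-- The factor 64 from the near corner and 4 from `κ` multiply to 256, and the scale `sq w` cancels.
quartic-bound : ∀ n w t e .{{_ : NonZero w}} →
  sq (n * n * w) ≤ 64 * e → e ≤ t * sq (2 * w) → n ^ 4 ≤ 256 * t
quartic-bound n w t e lower upper = *-cancelʳ-≤ _ _ (sq w) {{m*n≢0 w w}} (begin
  n ^ 4 * sq w             ≡⟨ sq-V n w ⟩
  sq (n * n * w)           ≤⟨ lower ⟩
  64 * e                   ≤⟨ *-monoʳ-≤ 64 upper ⟩
  64 * (t * sq (2 * w))    ≡⟨ collect-κ t w ⟩
  256 * t * sq w           ∎)
  where open ≤-Reasoning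

positive-summand : ∀ a {b} → 1 ≤ a + b → 1 ≤ a ⊎ 1 ≤ b
positive-summand zero 1≤b = inj₂ 1≤b
positive-summand (suc a) _ = inj₁ (s≤s z≤n)

necessarilyRecurrent⇒quartic : ∀ m t → NecessarilyRecurrentAfter (2 + m) t → (2 + m) ^ 4 ≤ 256 * t
necessarilyRecurrent⇒quartic m t recurrent =
  quartic-bound n W t (energy σ) {{W≢0}} lower upper
  where
  n = 2 + m
  open GridPotential n
  open Energy {n} glued
  corner : Vertex n
  corner = fromℕ (suc m) , fromℕ (suc m)

  σ : Config n
  σ = run empty (replicate t corner) .proj₁

  process : Process empty (replicate t corner) σ
  process = run empty (replicate t corner) .proj₂

  upper : energy σ ≤ t * κ
  upper = let open ≤-Reasoning in begin
    energy σ ≤⟨ energy-process glued-superharmonic t corner process ⟩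
    energy empty + t * value glued corner ≡⟨ cong₂ (λ e k → e + t * glued (suc k) (suc k)) energy-empty (toℕ-fromℕ (suc m)) ⟩
    t * glued n n ≤⟨ *-monoʳ-≤ t (glued-far-corner (s≤s z≤n)) ⟩
    t * κ ∎

  lower : sq V ≤ 64 * energy σ
  -- Recurrence forces a grain on `p` or `q`, and a single grain there already has energy at least
  -- V² / 64.
  lower with positive-summand (σ p) (recurrent⇒occupied (recurrent _ σ (length-replicate t) process))
  ... | inj₁ 1≤σp = ≤-trans (glued-near-corner 1 1 ≤-refl ≤-refl (n≤1+n 2) (s≤s (s≤s z≤n)))
                            (*-monoʳ-≤ 64 (grain≤energy σ p 1≤σp))
  ... | inj₂ 1≤σq = ≤-trans (glued-near-corner 1 2 ≤-refl (s≤s z≤n) ≤-refl (s≤s (s≤s z≤n)))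
                            (*-monoʳ-≤ 64 (grain≤energy σ q 1≤σq))

mainTheorem2 : Σ ℕ λ C → Σ ℕ λ N → ∀ n → N ≤ n →
    ∀ t → NecessarilyRecurrentAfter n t → n ^ 4 ≤ suc C * t
-- `suc 255` is the factor 256, and 2 ≤ n is what makes room for both `p` and `q`.
mainTheorem2 = 255 , 2 , bound
  where
  bound : ∀ n → 2 ≤ n → ∀ t → NecessarilyRecurrentAfter n t → n ^ 4 ≤ 256 * t
  bound (suc zero) (s≤s ())
  bound (suc (suc m)) _ t = necessarilyRecurrent⇒quartic m t
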